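{- Let $D_S$ be an $r$-regular digraph with self-loops of order $n$ with $\sigma$ self-loops and adjacency matrix $A(D_S)$. If $r,\lambda_2,\dots,\lambda_n$ are the eigenvalues of $A(D_S)$, then $n-r-\delta_\sigma,\,-\delta_\sigma-\lambda_2,\dots,-\delta_\sigma-\lambda_n$ are the eigenvalues of $A(\overline{D_S})$.
   Context: A digraph with self-loops $D_S$ is a pair $(V,\mathcal A)$ with $V$ a nonempty finite vertex set and $\mathcal A\subseteq V\times V$ a set of arcs; $S=\{v\in V:(v,v)\in\mathcal A\}$ is the self-loop set (possibly empty). The order is $n=|V|$ and $\sigma=|S|$. The adjacency matrix $A(D_S)=(a_{ij})$ has $a_{ij}=1$ if $(v_i,v_j)\in\mathcal A$ and $0$ otherwise; eigenvalues are counted with algebraic multiplicity. The out-degree of $v_i$ is $\sum_ja_{ij}$ and the in-degree is $\sum_ja_{ji}$ (each self-loop contributes $1$ to both). $D_S$ is $r$-regular if every vertex has in-degree and out-degree equal to $r$. Put $\delta_\sigma=1$ if $\sigma=0$ and $\delta_\sigma=0$ if $\sigma\ne0$. The complement $\overline{D_S}$ is the digraph with self-loops on $V$ with adjacency matrix $A(\overline{D_S})=J_n-\delta_\sigma I_n-A(D_S)$, where $J_n$ is the all-ones matrix and $I_n$ the identity matrix. -}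

module Defs where

open import Algebra.Bundles using (CommutativeRing; RawRing)
import Algebra.Definitions.RawMonoid as RawMonoidDefinitions
import Algebra.Definitions.RawSemiring as RawSemiringDefinitions
open import Data.Bool.Base using (Bool; true; false; not; _∧_; if_then_else_)
open import Data.Fin.Base using (Fin; zero; suc; toℕ; punchIn)
open import Data.Fin.Properties using (_≟_)
open import Data.Fin.Subset as Subset using (Subset; ∣_∣)
open import Data.Fin.Subset.Properties using (x∈p⇒∣p-x∣<∣p∣)
open import Data.Integer.Base as ℤ using (+_)
open import Data.List.Base as List using (List; []; _∷_)
open import Data.Nat.Base as ℕ using (ℕ; zero; suc)
import Data.Nat.Properties as ℕ
open import Data.Product.Base using (_×_; _,_; ∃-syntax)
open import Data.Rational.Base as ℚ using (ℚ; 0ℚ; 1ℚ; ½)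
import Data.Rational.Properties as ℚ
open import Data.Rational.Solver using (module +-*-Solver)
import Data.Vec.Base as Vec
import Data.Vec.Properties as Vec
open import Data.Vec.Functional using (Vector)
open import Level using (Level; _⊔_; 0ℓ)
open import Relation.Binary.PropositionalEquality
  using (_≡_; refl; sym; trans; cong; cong₂; subst)
open import Relation.Nullary.Decidable.Core using (does; yes; no)
open import Relation.Nullary.Negation.Core using (contradiction)

private
  variable
    c ℓ : Level
    n : ℕ

-- A real number is a Cauchy sequence of rationals; two are equal when their
-- difference tends to zero.

record ℝ : Set where
  field
    seq    : ℕ → ℚ
    cauchy : ∀ ε → 0ℚ ℚ.< ε →
             ∃[ N ] (∀ {m n} → N ℕ.≤ m → N ℕ.≤ n → ℚ.∣ seq m ℚ.- seq n ∣ ℚ.< ε)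

open ℝ

infix 4 _≈ℝ_

record _≈ℝ_ (x y : ℝ) : Set where
  constructor mk≈
  field
    limit : ∀ ε → 0ℚ ℚ.< ε →
            ∃[ N ] (∀ {n} → N ℕ.≤ n → ℚ.∣ seq x n ℚ.- seq y n ∣ ℚ.< ε)

open _≈ℝ_

private
  module Small {I : Set} (P : ℕ → I → Set)
               (P-antitone : ∀ {M N i} → M ℕ.≤ N → P N i → P M i) where

    IsSmall : (I → ℚ) → Set
    IsSmall f = ∀ ε → 0ℚ ℚ.< ε → ∃[ N ] (∀ {i} → P N i → ℚ.∣ f i ∣ ℚ.< ε)

    IsBounded : (I → ℚ) → Set
    IsBounded f = ∃[ B ] (0ℚ ℚ.< B × ∃[ N ] (∀ {i} → P N i → ℚ.∣ f i ∣ ℚ.≤ B))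

    small-resp : ∀ {f g : I → ℚ} → (∀ i → f i ≡ g i) → IsSmall f → IsSmall g
    small-resp f≡g small ε 0<ε with small ε 0<ε
    ... | N , f<ε = N , λ {i} p → subst (λ q → ℚ.∣ q ∣ ℚ.< ε) (f≡g i) (f<ε p)

    small-0 : IsSmall (λ _ → 0ℚ)
    small-0 ε 0<ε = 0 , λ _ → 0<ε

    small-neg : ∀ {f} → IsSmall f → IsSmall (λ i → ℚ.- f i)
    small-neg {f} small ε 0<ε with small ε 0<ε
    ... | N , f<ε = N , λ {i} p → subst (ℚ._< ε) (sym (ℚ.∣-p∣≡∣p∣ (f i))) (f<ε p)

    small-+ : ∀ {f g} → IsSmall f → IsSmall g → IsSmall (λ i → f i ℚ.+ g i)
    small-+ {f} {g} sf sg ε 0<ε =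
      let ε/2   = ½ ℚ.* ε
          0<ε/2 = subst (ℚ._< ε/2) (ℚ.*-zeroʳ ½) (ℚ.*-monoʳ-<-pos ½ 0<ε)
          M , f<  = sf ε/2 0<ε/2
          N , g<  = sg ε/2 0<ε/2
          halves  = trans (sym (ℚ.*-distribʳ-+ ε ½ ½)) (ℚ.*-identityˡ ε)
      in M ℕ.⊔ N , λ {i} p → ℚ.≤-<-trans (ℚ.∣p+q∣≤∣p∣+∣q∣ (f i) (g i))
           (subst (ℚ.∣ f i ∣ ℚ.+ ℚ.∣ g i ∣ ℚ.<_) halves
             (ℚ.+-mono-< (f< (P-antitone (ℕ.m≤m⊔n M N) p))
                         (g< (P-antitone (ℕ.m≤n⊔m M N) p))))

    small-* : ∀ {b f} → IsBounded b → IsSmall f → IsSmall (λ i → b i ℚ.* f i)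
    small-* {b} {f} (B , 0<B , M , b≤) sf ε 0<ε =
      let instance
            B-pos = ℚ.positive 0<B
            B-nonNeg = ℚ.pos⇒nonNeg B
            B-nonZero = ℚ.pos⇒nonZero B
            B⁻¹-pos = ℚ.1/pos⇒pos B
          δ       = ℚ.1/ B ℚ.* ε
          0<δ     = subst (ℚ._< δ) (ℚ.*-zeroʳ (ℚ.1/ B)) (ℚ.*-monoʳ-<-pos (ℚ.1/ B) 0<ε)
          Bδ≡ε    = trans (sym (ℚ.*-assoc B (ℚ.1/ B) ε))
                      (trans (cong (ℚ._* ε) (ℚ.*-inverseʳ B)) (ℚ.*-identityˡ ε))
          N , f<  = sf δ 0<δ
      in M ℕ.⊔ N , λ {i} p → subst (ℚ._< ε) (sym (ℚ.∣p*q∣≡∣p∣*∣q∣ (b i) (f i)))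
           (ℚ.≤-<-trans
             (ℚ.*-monoʳ-≤-nonNeg ℚ.∣ f i ∣ {{ℚ.∣-∣-nonNeg (f i)}}
               (b≤ (P-antitone (ℕ.m≤m⊔n M N) p)))
             (subst (B ℚ.* ℚ.∣ f i ∣ ℚ.<_) Bδ≡ε
               (ℚ.*-monoʳ-<-pos B (f< (P-antitone (ℕ.m≤n⊔m M N) p)))))

  module S₁ = Small ℕ._≤_ ℕ.≤-trans
  module S₂ = Small {I = ℕ × ℕ} (λ N (m , n) → N ℕ.≤ m × N ℕ.≤ n)
                    (λ M≤N (p , q) → ℕ.≤-trans M≤N p , ℕ.≤-trans M≤N q)

  Δ : ℝ → ℕ × ℕ → ℚ
  Δ x (m , n) = seq x m ℚ.- seq x n

  Δ-small : ∀ x → S₂.IsSmall (Δ x)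
  Δ-small x ε 0<ε with cauchy x ε 0<ε
  ... | N , h = N , λ (p , q) → h p q

  mkℝ : (s : ℕ → ℚ) → S₂.IsSmall (λ (m , n) → s m ℚ.- s n) → ℝ
  mkℝ s small = record
    { seq    = s
    ; cauchy = λ ε 0<ε → let N , h = small ε 0<ε in N , λ p q → h (p , q)
    }

  bounded : ∀ x → S₁.IsBounded (seq x)
  bounded x with cauchy x 1ℚ (ℚ.positive⁻¹ 1ℚ)
  ... | N , h = ℚ.∣ seq x N ∣ ℚ.+ 1ℚ
      , ℚ.+-mono-≤-< (ℚ.0≤∣p∣ (seq x N)) (ℚ.positive⁻¹ 1ℚ)
      , N , λ {n} N≤n → ℚ.≤-trans
          (subst (λ q → ℚ.∣ q ∣ ℚ.≤ ℚ.∣ seq x N ∣ ℚ.+ ℚ.∣ seq x n ℚ.- seq x N ∣)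
            (split (seq x N) (seq x n))
            (ℚ.∣p+q∣≤∣p∣+∣q∣ (seq x N) (seq x n ℚ.- seq x N)))
          (ℚ.+-monoʳ-≤ ℚ.∣ seq x N ∣ (ℚ.<⇒≤ (h N≤n ℕ.≤-refl)))
    where
    split : ∀ p q → p ℚ.+ (q ℚ.- p) ≡ q
    split = solve 2 (λ p q → p :+ (q :- p) := q) refl
      where open +-*-Solver

  bounded₁ : ∀ x → S₂.IsBounded (λ (m , n) → seq x m)
  bounded₁ x = let B , 0<B , N , h = bounded x in
    B , 0<B , N , λ { {m , n} (p , q) → h {m} p }

  bounded₂ : ∀ x → S₂.IsBounded (λ (m , n) → seq x n)
  bounded₂ x = let B , 0<B , N , h = bounded x in
    B , 0<B , N , λ { {m , n} (p , q) → h {n} q }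

  +-diff : ∀ p q r s → (p ℚ.- q) ℚ.+ (r ℚ.- s) ≡ (p ℚ.+ r) ℚ.- (q ℚ.+ s)
  +-diff = solve 4 (λ p q r s → (p :- q) :+ (r :- s) := (p :+ r) :- (q :+ s)) refl
    where open +-*-Solver

  *-diff : ∀ p q r s → (p ℚ.* (r ℚ.- s)) ℚ.+ (s ℚ.* (p ℚ.- q)) ≡ p ℚ.* r ℚ.- q ℚ.* s
  *-diff = solve 4 (λ p q r s → (p :* (r :- s)) :+ (s :* (p :- q)) := p :* r :- q :* s) refl
    where open +-*-Solver

  neg-diff : ∀ p q → ℚ.- (p ℚ.- q) ≡ (ℚ.- p) ℚ.- (ℚ.- q)
  neg-diff = solve 2 (λ p q → :- (p :- q) := (:- p) :- (:- q)) refl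
    where open +-*-Solver

  abstract
    const-small : ∀ (q : ℚ) → S₂.IsSmall (λ _ → q ℚ.- q)
    const-small q = S₂.small-resp (λ _ → sym (ℚ.+-inverseʳ q)) S₂.small-0

    +-small : ∀ x y → S₂.IsSmall (λ (m , n) →
      (seq x m ℚ.+ seq y m) ℚ.- (seq x n ℚ.+ seq y n))
    +-small x y = S₂.small-resp
      (λ (m , n) → +-diff (seq x m) (seq x n) (seq y m) (seq y n))
      (S₂.small-+ (Δ-small x) (Δ-small y))

    *-small : ∀ x y → S₂.IsSmall (λ (m , n) →
      (seq x m ℚ.* seq y m) ℚ.- (seq x n ℚ.* seq y n))
    *-small x y = S₂.small-resp
      (λ (m , n) → *-diff (seq x m) (seq x n) (seq y m) (seq y n))
      (S₂.small-+ (S₂.small-* (bounded₁ x) (Δ-small y))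
                  (S₂.small-* (bounded₂ y) (Δ-small x)))

    neg-small : ∀ x → S₂.IsSmall (λ (m , n) → (ℚ.- seq x m) ℚ.- (ℚ.- seq x n))
    neg-small x = S₂.small-resp
      (λ (m , n) → neg-diff (seq x m) (seq x n)) (S₂.small-neg (Δ-small x))

fromℚ : ℚ → ℝ
fromℚ q = mkℝ (λ _ → q) (const-small q)

infixl 6 _+ℝ_
infixl 7 _*ℝ_
infix 8 -ℝ_

_+ℝ_ : ℝ → ℝ → ℝ
x +ℝ y = mkℝ (λ n → seq x n ℚ.+ seq y n) (+-small x y)

_*ℝ_ : ℝ → ℝ → ℝ
x *ℝ y = mkℝ (λ n → seq x n ℚ.* seq y n) (*-small x y)

-ℝ_ : ℝ → ℝ
-ℝ x = mkℝ (λ n → ℚ.- seq x n) (neg-small x)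

private
  pointwise : ∀ {x y} → (∀ n → seq x n ≡ seq y n) → x ≈ℝ y
  pointwise {x} {y} eq = mk≈ (S₁.small-resp
    (λ n → trans (sym (ℚ.+-inverseʳ (seq x n))) (cong (λ q → seq x n ℚ.- q) (eq n)))
    S₁.small-0)

  ≈ℝ-sym : ∀ {x y} → x ≈ℝ y → y ≈ℝ x
  ≈ℝ-sym {x} {y} (mk≈ p) = mk≈ (S₁.small-resp (λ n → lemma (seq x n) (seq y n)) (S₁.small-neg p))
    where
    lemma : ∀ p q → ℚ.- (p ℚ.- q) ≡ q ℚ.- p
    lemma = solve 2 (λ p q → :- (p :- q) := q :- p) refl
      where open +-*-Solver

  ≈ℝ-trans : ∀ {x y z} → x ≈ℝ y → y ≈ℝ z → x ≈ℝ z
  ≈ℝ-trans {x} {y} {z} (mk≈ p) (mk≈ q) =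
    mk≈ (S₁.small-resp (λ n → lemma (seq x n) (seq y n) (seq z n)) (S₁.small-+ p q))
    where
    lemma : ∀ p q r → (p ℚ.- q) ℚ.+ (q ℚ.- r) ≡ p ℚ.- r
    lemma = solve 3 (λ p q r → (p :- q) :+ (q :- r) := p :- r) refl
      where open +-*-Solver

  +ℝ-cong : ∀ {x y u v} → x ≈ℝ y → u ≈ℝ v → (x +ℝ u) ≈ℝ (y +ℝ v)
  +ℝ-cong {x} {y} {u} {v} (mk≈ p) (mk≈ q) = mk≈ (S₁.small-resp
    (λ n → +-diff (seq x n) (seq y n) (seq u n) (seq v n)) (S₁.small-+ p q))

  *ℝ-cong : ∀ {x y u v} → x ≈ℝ y → u ≈ℝ v → (x *ℝ u) ≈ℝ (y *ℝ v)
  *ℝ-cong {x} {y} {u} {v} (mk≈ p) (mk≈ q) = mk≈ (S₁.small-resp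
    (λ n → *-diff (seq x n) (seq y n) (seq u n) (seq v n))
    (S₁.small-+ (S₁.small-* (bounded x) q) (S₁.small-* (bounded v) p)))

  -ℝ-cong : ∀ {x y} → x ≈ℝ y → (-ℝ x) ≈ℝ (-ℝ y)
  -ℝ-cong {x} {y} (mk≈ p) = mk≈ (S₁.small-resp
    (λ n → neg-diff (seq x n) (seq y n)) (S₁.small-neg p))

ℝ-commutativeRing : CommutativeRing 0ℓ 0ℓ
ℝ-commutativeRing = record
  { Carrier = ℝ
  ; _≈_ = _≈ℝ_
  ; _+_ = _+ℝ_
  ; _*_ = _*ℝ_
  ; -_ = -ℝ_
  ; 0# = fromℚ 0ℚ
  ; 1# = fromℚ 1ℚ
  ; isCommutativeRing = record
    { isRing = record
      { +-isAbelianGroup = record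
        { isGroup = record
          { isMonoid = record
            { isSemigroup = record
              { isMagma = record
                { isEquivalence = record
                  { refl = pointwise (λ _ → refl) ; sym = ≈ℝ-sym ; trans = ≈ℝ-trans }
                ; ∙-cong = +ℝ-cong
                }
              ; assoc = λ x y z → pointwise λ n → ℚ.+-assoc (seq x n) (seq y n) (seq z n)
              }
            ; identity = (λ x → pointwise λ n → ℚ.+-identityˡ (seq x n))
                       , (λ x → pointwise λ n → ℚ.+-identityʳ (seq x n))
            }
          ; inverse = (λ x → pointwise λ n → ℚ.+-inverseˡ (seq x n))
                    , (λ x → pointwise λ n → ℚ.+-inverseʳ (seq x n))
          ; ⁻¹-cong = -ℝ-cong
          }
        ; comm = λ x y → pointwise λ n → ℚ.+-comm (seq x n) (seq y n)
        }
      ; *-cong = *ℝ-cong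
      ; *-assoc = λ x y z → pointwise λ n → ℚ.*-assoc (seq x n) (seq y n) (seq z n)
      ; *-identity = (λ x → pointwise λ n → ℚ.*-identityˡ (seq x n))
                   , (λ x → pointwise λ n → ℚ.*-identityʳ (seq x n))
      ; distrib = (λ x y z → pointwise λ n → ℚ.*-distribˡ-+ (seq x n) (seq y n) (seq z n))
                , (λ x y z → pointwise λ n → ℚ.*-distribʳ-+ (seq x n) (seq y n) (seq z n))
      }
    ; *-comm = λ x y → pointwise λ n → ℚ.*-comm (seq x n) (seq y n)
    }
  }


record ℂ : Set where
  constructor _+i_
  field
    re im : ℝ

open ℂ

infix 4 _≈ℂ_

record _≈ℂ_ (z w : ℂ) : Set where
  constructor mk≈
  field
    re≈ : re z ≈ℝ re w
    im≈ : im z ≈ℝ im w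

infixl 6 _+ℂ_ _-ℂ_
infixl 7 _*ℂ_
infix 8 -ℂ_

_+ℂ_ : ℂ → ℂ → ℂ
z +ℂ w = (re z +ℝ re w) +i (im z +ℝ im w)

_*ℂ_ : ℂ → ℂ → ℂ
z *ℂ w = (re z *ℝ re w +ℝ (-ℝ (im z *ℝ im w))) +i (re z *ℝ im w +ℝ im z *ℝ re w)

-ℂ_ : ℂ → ℂ
-ℂ z = (-ℝ re z) +i (-ℝ im z)

_-ℂ_ : ℂ → ℂ → ℂ
z -ℂ w = z +ℂ (-ℂ w)

0ℂ 1ℂ : ℂ
0ℂ = fromℚ 0ℚ +i fromℚ 0ℚ
1ℂ = fromℚ 1ℚ +i fromℚ 0ℚ

private
  open CommutativeRing ℝ-commutativeRing using ()
    renaming ( refl to ≈-refl; sym to ≈-sym; trans to ≈-trans; +-cong to ℝ+-cong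
             ; *-cong to ℝ*-cong; -‿cong to ℝ-‿cong; +-assoc to ℝ+-assoc
             ; +-comm to ℝ+-comm; +-identityˡ to ℝ+-identityˡ; +-identityʳ to ℝ+-identityʳ
             ; -‿inverseˡ to ℝ-inverseˡ; -‿inverseʳ to ℝ-inverseʳ)

  *ℂ-assoc : ∀ x y z → (x *ℂ y) *ℂ z ≈ℂ x *ℂ (y *ℂ z)
  *ℂ-assoc (a +i b) (c +i d) (e +i f) = mk≈
    (pointwise λ n → solve 6 (λ a b c d e f →
      (a :* c :+ :- (b :* d)) :* e :+ :- ((a :* d :+ b :* c) :* f) :=
      a :* (c :* e :+ :- (d :* f)) :+ :- (b :* (c :* f :+ d :* e))) refl
      (seq a n) (seq b n) (seq c n) (seq d n) (seq e n) (seq f n))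
    (pointwise λ n → solve 6 (λ a b c d e f →
      (a :* c :+ :- (b :* d)) :* f :+ (a :* d :+ b :* c) :* e :=
      a :* (c :* f :+ d :* e) :+ b :* (c :* e :+ :- (d :* f))) refl
      (seq a n) (seq b n) (seq c n) (seq d n) (seq e n) (seq f n))
    where open +-*-Solver

  *ℂ-comm : ∀ x y → x *ℂ y ≈ℂ y *ℂ x
  *ℂ-comm (a +i b) (c +i d) = mk≈
    (pointwise λ n → solve 4 (λ a b c d →
      a :* c :+ :- (b :* d) := c :* a :+ :- (d :* b)) refl
      (seq a n) (seq b n) (seq c n) (seq d n))
    (pointwise λ n → solve 4 (λ a b c d →
      a :* d :+ b :* c := c :* b :+ d :* a) refl
      (seq a n) (seq b n) (seq c n) (seq d n))
    where open +-*-Solver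

  *ℂ-identityˡ : ∀ x → 1ℂ *ℂ x ≈ℂ x
  *ℂ-identityˡ (a +i b) = mk≈
    (pointwise λ n → solve 2 (λ a b →
      con 1ℚ :* a :+ :- (con 0ℚ :* b) := a) refl (seq a n) (seq b n))
    (pointwise λ n → solve 2 (λ a b →
      con 1ℚ :* b :+ con 0ℚ :* a := b) refl (seq a n) (seq b n))
    where open +-*-Solver

  *ℂ-distribˡ : ∀ x y z → x *ℂ (y +ℂ z) ≈ℂ x *ℂ y +ℂ x *ℂ z
  *ℂ-distribˡ (a +i b) (c +i d) (e +i f) = mk≈
    (pointwise λ n → solve 6 (λ a b c d e f →
      a :* (c :+ e) :+ :- (b :* (d :+ f)) :=
      (a :* c :+ :- (b :* d)) :+ (a :* e :+ :- (b :* f))) refl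
      (seq a n) (seq b n) (seq c n) (seq d n) (seq e n) (seq f n))
    (pointwise λ n → solve 6 (λ a b c d e f →
      a :* (d :+ f) :+ b :* (c :+ e) :=
      (a :* d :+ b :* c) :+ (a :* f :+ b :* e)) refl
      (seq a n) (seq b n) (seq c n) (seq d n) (seq e n) (seq f n))
    where open +-*-Solver

  +ℂ-cong : ∀ {x y u v} → x ≈ℂ y → u ≈ℂ v → x +ℂ u ≈ℂ y +ℂ v
  +ℂ-cong (mk≈ p q) (mk≈ p′ q′) = mk≈ (ℝ+-cong p p′) (ℝ+-cong q q′)

  *ℂ-cong : ∀ {x y u v} → x ≈ℂ y → u ≈ℂ v → x *ℂ u ≈ℂ y *ℂ v
  *ℂ-cong (mk≈ p q) (mk≈ p′ q′) = mk≈
    (ℝ+-cong (ℝ*-cong p p′) (ℝ-‿cong (ℝ*-cong q q′)))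
    (ℝ+-cong (ℝ*-cong p q′) (ℝ*-cong q p′))

  ≈ℂ-trans : ∀ {x y z} → x ≈ℂ y → y ≈ℂ z → x ≈ℂ z
  ≈ℂ-trans (mk≈ p q) (mk≈ p′ q′) = mk≈ (≈-trans p p′) (≈-trans q q′)

ℂ-commutativeRing : CommutativeRing 0ℓ 0ℓ
ℂ-commutativeRing = record
  { Carrier = ℂ
  ; _≈_ = _≈ℂ_
  ; _+_ = _+ℂ_
  ; _*_ = _*ℂ_
  ; -_ = -ℂ_
  ; 0# = 0ℂ
  ; 1# = 1ℂ
  ; isCommutativeRing = record
    { isRing = record
      { +-isAbelianGroup = record
        { isGroup = record
          { isMonoid = record
            { isSemigroup = record
              { isMagma = record
                { isEquivalence = record
                  { refl  = mk≈ ≈-refl ≈-refl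
                  ; sym   = λ (mk≈ p q) → mk≈ (≈-sym p) (≈-sym q)
                  ; trans = ≈ℂ-trans
                  }
                ; ∙-cong = +ℂ-cong
                }
              ; assoc = λ x y z →
                  mk≈ (ℝ+-assoc (re x) (re y) (re z)) (ℝ+-assoc (im x) (im y) (im z))
              }
            ; identity = (λ x → mk≈ (ℝ+-identityˡ (re x)) (ℝ+-identityˡ (im x)))
                       , (λ x → mk≈ (ℝ+-identityʳ (re x)) (ℝ+-identityʳ (im x)))
            }
          ; inverse = (λ x → mk≈ (ℝ-inverseˡ (re x)) (ℝ-inverseˡ (im x)))
                    , (λ x → mk≈ (ℝ-inverseʳ (re x)) (ℝ-inverseʳ (im x)))
          ; ⁻¹-cong = λ (mk≈ p q) → mk≈ (ℝ-‿cong p) (ℝ-‿cong q)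
          }
        ; comm = λ x y → mk≈ (ℝ+-comm (re x) (re y)) (ℝ+-comm (im x) (im y))
        }
      ; *-cong = *ℂ-cong
      ; *-assoc = *ℂ-assoc
      ; *-identity = *ℂ-identityˡ
                   , (λ x → ≈ℂ-trans (*ℂ-comm x 1ℂ) (*ℂ-identityˡ x))
      ; distrib = *ℂ-distribˡ
                , (λ x y z → ≈ℂ-trans (*ℂ-comm (y +ℂ z) x)
                    (≈ℂ-trans (*ℂ-distribˡ x y z) (+ℂ-cong (*ℂ-comm x y) (*ℂ-comm x z))))
      }
    ; *-comm = *ℂ-comm
    }
  }

ℂ-rawRing : RawRing 0ℓ 0ℓ
ℂ-rawRing = CommutativeRing.rawRing ℂ-commutativeRing

fromℕ : ℕ → ℂ
fromℕ k = k · 1ℂ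
  where open RawMonoidDefinitions (RawRing.+-rawMonoid ℂ-rawRing) renaming (_×_ to _·_)

-- Univariate polynomials, as coefficient lists with the constant term first.
-- Trailing zeros are allowed, so equality compares coefficients.

module Polynomial (R : RawRing c ℓ) where
  open RawRing R

  Poly : Set c
  Poly = List Carrier

  coeff : Poly → ℕ → Carrier
  coeff []      _       = 0#
  coeff (a ∷ p) zero    = a
  coeff (a ∷ p) (suc k) = coeff p k

  infix 4 _≈ₚ_

  record _≈ₚ_ (p q : Poly) : Set (c ⊔ ℓ) where
    constructor mk≈
    field
      coeff≈ : ∀ k → coeff p k ≈ coeff q k

  infixl 6 _+ₚ_ _-ₚ_
  infixl 7 _*ₚ_

  _+ₚ_ : Poly → Poly → Poly
  []      +ₚ q       = q
  (a ∷ p) +ₚ []      = a ∷ p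
  (a ∷ p) +ₚ (b ∷ q) = (a + b) ∷ (p +ₚ q)

  _*ₚ_ : Poly → Poly → Poly
  []      *ₚ q = []
  (a ∷ p) *ₚ q = List.map (a *_) q +ₚ (0# ∷ (p *ₚ q))

  -ₚ_ : Poly → Poly
  -ₚ p = List.map -_ p

  _-ₚ_ : Poly → Poly → Poly
  p -ₚ q = p +ₚ (-ₚ q)

  const : Carrier → Poly
  const a = a ∷ []

  X : Poly
  X = 0# ∷ 1# ∷ []

  polyRawRing : RawRing c (c ⊔ ℓ)
  polyRawRing = record
    { Carrier = Poly
    ; _≈_ = _≈ₚ_
    ; _+_ = _+ₚ_
    ; _*_ = _*ₚ_
    ; -_  = -ₚ_
    ; 0#  = []
    ; 1#  = const 1#
    }

Matrix : Set c → ℕ → Set c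
Matrix A n = Vector (Vector A n) n

module LinearAlgebra (R : RawRing c ℓ) where
  open RawRing R
  open RawMonoidDefinitions +-rawMonoid using (sum)
  open RawSemiringDefinitions rawSemiring using (_^_)

  identity : Matrix Carrier n
  identity i j = if does (i ≟ j) then 1# else 0#

  det : Matrix Carrier n → Carrier
  det {zero}  M = 1#
  det {suc n} M =
    sum λ j → (- 1#) ^ toℕ j * M zero j * det (λ i k → M (suc i) (punchIn j k))

module Spectrum (R : RawRing c ℓ) where
  open RawRing R using (Carrier)
  open Polynomial R
  open LinearAlgebra polyRawRing using (det; identity)
  open RawMonoidDefinitions (RawRing.*-rawMonoid polyRawRing) renaming (sum to product)

  charPoly : Matrix Carrier n → Poly
  charPoly M = det λ i j → X *ₚ identity i j -ₚ const (M i j)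

  -- The entries of μ are the eigenvalues of M, each listed as often as its
  -- algebraic multiplicity: det (X I - M) = ∏ᵢ (X - μᵢ).
  HasEigenvalues : Matrix Carrier n → Vector Carrier n → Set (c ⊔ ℓ)
  HasEigenvalues M μ = charPoly M ≈ₚ product λ i → X -ₚ const (μ i)

open Spectrum ℂ-rawRing public using (HasEigenvalues)

-- The vertices are Fin n, and arc is the characteristic function of the arc
-- set; arc v v ≡ true is a self-loop at v.

record Digraph (n : ℕ) : Set where
  field
    arc : Fin n → Fin n → Bool

  S : Subset n
  S = Vec.tabulate (λ v → arc v v)

  σ : ℕ
  σ = ∣ S ∣

  adjacency : Matrix ℕ n
  adjacency i j = if arc i j then 1 else 0

  open RawMonoidDefinitions ℕ.+-0-rawMonoid using (sum)

  outDegree inDegree : Fin n → ℕ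
  outDegree i = sum λ j → adjacency i j
  inDegree  i = sum λ j → adjacency j i

open Digraph public

Regular : ℕ → Digraph n → Set
Regular r D = ∀ v → inDegree D v ≡ r × outDegree D v ≡ r

δ : ℕ → ℕ
δ zero    = 1
δ (suc _) = 0

complement : Digraph n → Digraph n
complement D .arc i j = not (arc D i j) ∧ not ((σ D ℕ.≡ᵇ 0) ∧ does (i ≟ j))

A : Digraph n → Matrix ℂ n
A D i j = fromℕ (adjacency D i j)

private
  σ≡0⇒loopless : (D : Digraph n) → σ D ≡ 0 → ∀ v → arc D v v ≡ false
  σ≡0⇒loopless D σ≡0 v with arc D v v in eq
  ... | false = refl
  ... | true  = contradiction
    (subst (∣ S D Subset.- v ∣ ℕ.<_) σ≡0
      (x∈p⇒∣p-x∣<∣p∣ (Vec.lookup⇒[]= v (S D) (trans (Vec.lookup∘tabulate _ v) eq))))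
    λ ()

-- The complement is the digraph with adjacency matrix J - δ_σ I - A.
complement-adjacency : (D : Digraph n) → ∀ i j →
  + adjacency (complement D) i j ≡
  ℤ.1ℤ ℤ.- + δ (σ D) ℤ.* LinearAlgebra.identity ℤ.+-*-rawRing i j ℤ.- + adjacency D i j
complement-adjacency D i j with σ D in σ≡ | i ≟ j
... | suc _ | _ with arc D i j
...   | true  = refl
...   | false = refl
complement-adjacency D i j | zero | no _ with arc D i j
...   | true  = refl
...   | false = refl
complement-adjacency D i j | zero | yes refl rewrite σ≡0⇒loopless D σ≡ i = refl

module Submission where

-- Put Y = X + δ, N = Y I + A and T = X I - Ā, so that T + J = N.  Replacing the
-- first row by the sum of all rows shows det N = (Y + r) D, where D is det N
-- with the first row replaced by ones, and det T = (X + δ + r - n) D, since the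
-- rows of N below the first differ from those of T by that row of ones.  On the
-- other hand det N = (-1)ⁿ χ_A(-Y) = (Y + r) ∏ (Y + μᵢ), and the monic factor
-- Y + r cancels, which leaves D = ∏ (Y + μᵢ).

open import Defs
open import Algebra.Bundles using (CommutativeRing; Monoid; RawRing)
import Algebra.Definitions.RawSemiring as RawSemiringDefinitions
open import Algebra.Morphism.Structures using (IsMonoidHomomorphism; IsRingHomomorphism)
import Algebra.Properties.CommutativeMonoid.Sum as CommutativeMonoidSum
import Algebra.Properties.CommutativeSemigroup as CommutativeSemigroupProperties
import Algebra.Properties.Monoid.Mult as MonoidMult
import Algebra.Properties.Monoid.Sum as MonoidSum
import Algebra.Properties.Ring as RingProperties
import Algebra.Properties.Semiring.Mult as SemiringMult
import Algebra.Properties.Semiring.Sum as SemiringSum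
open import Data.Bool.Base using (true; false; if_then_else_)
open import Data.Bool.Properties using (if-float)
open import Data.Fin.Base using (Fin; zero; suc; toℕ; punchIn; inject₁; _≤_)
open import Data.Fin.Properties using (toℕ-inject₁; _≟_)
open import Data.Integer.Base as ℤ using (+_)
import Data.Integer.Properties as ℤ
open import Data.Integer.Solver using (module +-*-Solver)
open import Data.List.Base as List using ()
open import Data.Nat.Base as ℕ using (ℕ; zero; suc; z≤n; s≤s)
import Data.Nat.Properties as ℕ
open import Data.Product.Base using (_,_; proj₁)
open import Function.Base using (_∘_)
open import Level using (_⊔_)
open import Relation.Binary.PropositionalEquality as ≡ using (_≡_)
import Relation.Binary.Reasoning.Setoid as SetoidReasoning
open import Relation.Binary.Structures using (IsEquivalence)
open import Relation.Nullary.Decidable.Core using (does)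

-- Polynomials as coefficient lists

-- Eigenvectors would not settle algebraic multiplicities, since the adjacency matrix of a digraph
-- need not be diagonalisable. A spectrum is here a factorisation of a characteristic polynomial, so
-- everything becomes an identity between determinants over `R[X]`, for an arbitrary commutative
-- ring `R`. This generality also suits `ℂ`, whose equality is that of Cauchy sequences and cannot
-- be decided: there is no search for pivots and no division. Passing from `T` to `N` works because
-- J has rank one: once a row of ones stands on top, adding J to the rows below it is a row
-- operation. Constant column sums are what puts that row there. The hypothesis on A enters through
-- the substitution of -Y for X. Being a ring endomorphism of `R[X]`, it can be carried through
-- determinant and product alike. The final cancellation rests on the leading coefficient one
-- instead of on the absence of zero divisors.

module PolynomialRing {c ℓ} (R : CommutativeRing c ℓ) where
  open List using ([]; _∷_)
  open CommutativeRing R hiding (zero)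
  open Polynomial rawRing
  open RingProperties ring using (-0#≈0#)
  private
    module +ᵖ = CommutativeSemigroupProperties +-commutativeSemigroup

  coeff-+ : ∀ p q k → coeff (p +ₚ q) k ≈ coeff p k + coeff q k
  coeff-+ []      q       k       = sym (+-identityˡ _)
  coeff-+ (a ∷ p) []      k       = sym (+-identityʳ _)
  coeff-+ (a ∷ p) (b ∷ q) zero    = refl
  coeff-+ (a ∷ p) (b ∷ q) (suc k) = coeff-+ p q k

  coeff-neg : ∀ p k → coeff (-ₚ p) k ≈ - coeff p k
  coeff-neg []      k       = sym -0#≈0#
  coeff-neg (a ∷ p) zero    = refl
  coeff-neg (a ∷ p) (suc k) = coeff-neg p k

  infixr 7 _•_

  _•_ : Carrier → Poly → Poly
  a • p = List.map (a *_) p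

  coeff-• : ∀ a p k → coeff (a • p) k ≈ a * coeff p k
  coeff-• a []      k       = sym (zeroʳ a)
  coeff-• a (b ∷ p) zero    = refl
  coeff-• a (b ∷ p) (suc k) = coeff-• a p k

  ≈ₚ-isEquivalence : IsEquivalence _≈ₚ_
  ≈ₚ-isEquivalence = record
    { refl  = mk≈ λ _ → refl
    ; sym   = λ (mk≈ e) → mk≈ λ k → sym (e k)
    ; trans = λ (mk≈ e) (mk≈ e′) → mk≈ λ k → trans (e k) (e′ k)
    }

  private
    module P = IsEquivalence ≈ₚ-isEquivalence

  ∷-cong : ∀ {a b p q} → a ≈ b → p ≈ₚ q → a ∷ p ≈ₚ b ∷ q
  ∷-cong a≈b (mk≈ e) = mk≈ λ { zero → a≈b ; (suc k) → e k }

  +ₚ-cong : ∀ {p p′ q q′} → p ≈ₚ p′ → q ≈ₚ q′ → p +ₚ q ≈ₚ p′ +ₚ q′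
  +ₚ-cong {p} {p′} {q} {q′} (mk≈ e) (mk≈ e′) = mk≈ λ k →
    trans (coeff-+ p q k) (trans (+-cong (e k) (e′ k)) (sym (coeff-+ p′ q′ k)))

  +ₚ-assoc : ∀ p q r → (p +ₚ q) +ₚ r ≈ₚ p +ₚ (q +ₚ r)
  +ₚ-assoc p q r = mk≈ λ k → begin
    coeff ((p +ₚ q) +ₚ r) k               ≈⟨ coeff-+ (p +ₚ q) r k ⟩
    coeff (p +ₚ q) k + coeff r k          ≈⟨ +-congʳ (coeff-+ p q k) ⟩
    coeff p k + coeff q k + coeff r k     ≈⟨ +-assoc _ _ _ ⟩
    coeff p k + (coeff q k + coeff r k)   ≈⟨ +-congˡ (coeff-+ q r k) ⟨
    coeff p k + coeff (q +ₚ r) k          ≈⟨ coeff-+ p (q +ₚ r) k ⟨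
    coeff (p +ₚ (q +ₚ r)) k               ∎
    where open SetoidReasoning setoid

  +ₚ-comm : ∀ p q → p +ₚ q ≈ₚ q +ₚ p
  +ₚ-comm p q = mk≈ λ k →
    trans (coeff-+ p q k) (trans (+-comm _ _) (sym (coeff-+ q p k)))

  +ₚ-identityʳ : ∀ p → p +ₚ [] ≈ₚ p
  +ₚ-identityʳ p = +ₚ-comm p []

  -ₚ-inverseʳ : ∀ p → p +ₚ (-ₚ p) ≈ₚ []
  -ₚ-inverseʳ p = mk≈ λ k → trans (coeff-+ p (-ₚ p) k)
    (trans (+-congˡ (coeff-neg p k)) (-‿inverseʳ _))

  -ₚ-cong : ∀ {p q} → p ≈ₚ q → -ₚ p ≈ₚ -ₚ q
  -ₚ-cong {p} {q} (mk≈ e) = mk≈ λ k →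
    trans (coeff-neg p k) (trans (-‿cong (e k)) (sym (coeff-neg q k)))

  •-cong : ∀ {a b p q} → a ≈ b → p ≈ₚ q → a • p ≈ₚ b • q
  •-cong {a} {b} {p} {q} a≈b (mk≈ e) = mk≈ λ k →
    trans (coeff-• a p k) (trans (*-cong a≈b (e k)) (sym (coeff-• b q k)))

  •-distribˡ : ∀ a p q → a • (p +ₚ q) ≈ₚ a • p +ₚ a • q
  •-distribˡ a p q = mk≈ λ k → trans (coeff-• a (p +ₚ q) k)
    (trans (*-congˡ (coeff-+ p q k)) (trans (distribˡ _ _ _)
      (sym (trans (coeff-+ (a • p) (a • q) k) (+-cong (coeff-• a p k) (coeff-• a q k))))))

  •-distribʳ : ∀ a b p → (a + b) • p ≈ₚ a • p +ₚ b • p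
  •-distribʳ a b p = mk≈ λ k → trans (coeff-• (a + b) p k)
    (trans (distribʳ _ _ _)
      (sym (trans (coeff-+ (a • p) (b • p) k) (+-cong (coeff-• a p k) (coeff-• b p k)))))

  •-assoc : ∀ a b p → (a * b) • p ≈ₚ a • b • p
  •-assoc a b p = mk≈ λ k → trans (coeff-• (a * b) p k)
    (trans (*-assoc _ _ _) (sym (trans (coeff-• a (b • p) k) (*-congˡ (coeff-• b p k)))))

  •-zero : ∀ {a} p → a ≈ 0# → a • p ≈ₚ []
  •-zero p a≈0 = mk≈ λ k → trans (coeff-• _ p k) (trans (*-congʳ a≈0) (zeroˡ _))

  0∷[]≈[] : 0# ∷ [] ≈ₚ []
  0∷[]≈[] = mk≈ λ { zero → refl ; (suc _) → refl }

  -- Each clause of `_*ₚ_` yields a scalar multiple plus a shifted product; this regroups the sum of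
  -- two such results, as distributivity requires.
  ∷-interchange : ∀ p q r s → (p +ₚ (0# ∷ q)) +ₚ (r +ₚ (0# ∷ s)) ≈ₚ (p +ₚ r) +ₚ (0# ∷ (q +ₚ s))
  ∷-interchange p q r s = P.trans (mk≈ λ k → begin
    coeff ((p +ₚ q′) +ₚ (r +ₚ s′)) k                       ≈⟨ expand p q′ r s′ k ⟩
    (coeff p k + coeff q′ k) + (coeff r k + coeff s′ k)    ≈⟨ +ᵖ.interchange _ _ _ _ ⟩
    (coeff p k + coeff r k) + (coeff q′ k + coeff s′ k)    ≈⟨ expand p r q′ s′ k ⟨
    coeff ((p +ₚ r) +ₚ (q′ +ₚ s′)) k                       ∎)
    (+ₚ-cong {p +ₚ r} P.refl (∷-cong (+-identityˡ 0#) P.refl))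
    where
    open SetoidReasoning setoid
    q′ = 0# ∷ q
    s′ = 0# ∷ s
    expand : ∀ p q r s k → coeff ((p +ₚ q) +ₚ (r +ₚ s)) k ≈
                           (coeff p k + coeff q k) + (coeff r k + coeff s k)
    expand p q r s k = trans (coeff-+ (p +ₚ q) (r +ₚ s) k)
      (+-cong (coeff-+ p q k) (coeff-+ r s k))

  *ₚ-zeroˡ : ∀ p q → p ≈ₚ [] → p *ₚ q ≈ₚ []
  *ₚ-zeroˡ []      q _       = P.refl
  *ₚ-zeroˡ (a ∷ p) q (mk≈ e) = P.trans
    (+ₚ-cong (•-zero q (e 0)) (∷-cong refl (*ₚ-zeroˡ p q (mk≈ λ k → e (suc k)))))
    0∷[]≈[]

  *ₚ-congˡ : ∀ p {q q′} → q ≈ₚ q′ → p *ₚ q ≈ₚ p *ₚ q′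
  *ₚ-congˡ []      e = P.refl
  *ₚ-congˡ (a ∷ p) e = +ₚ-cong (•-cong refl e) (∷-cong refl (*ₚ-congˡ p e))

  *ₚ-zeroʳ : ∀ p → p *ₚ [] ≈ₚ []
  *ₚ-zeroʳ []      = P.refl
  *ₚ-zeroʳ (a ∷ p) = P.trans (∷-cong refl (*ₚ-zeroʳ p)) 0∷[]≈[]

  -- The mirror image of the defining clause, recursing on the second factor; commutativity follows
  -- by matching the two.
  *ₚ-∷ : ∀ p b q → p *ₚ (b ∷ q) ≈ₚ b • p +ₚ (0# ∷ (p *ₚ q))
  *ₚ-∷ []      b q = P.sym 0∷[]≈[]
  *ₚ-∷ (a ∷ p) b q = ∷-cong (+-congʳ (*-comm a b)) (P.trans
    (+ₚ-cong {a • q} P.refl (*ₚ-∷ p b q))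
    (P.trans (P.sym (+ₚ-assoc (a • q) (b • p) _))
    (P.trans (+ₚ-cong (+ₚ-comm (a • q) (b • p)) P.refl)
      (+ₚ-assoc (b • p) (a • q) _))))

  *ₚ-comm : ∀ p q → p *ₚ q ≈ₚ q *ₚ p
  *ₚ-comm []      q = P.sym (*ₚ-zeroʳ q)
  *ₚ-comm (a ∷ p) q = P.trans
    (+ₚ-cong {a • q} P.refl (∷-cong refl (*ₚ-comm p q)))
    (P.sym (*ₚ-∷ q a p))

  -- Multiplication recurses on the list of its left factor, whereas `_≈ₚ_` ignores list length.
  -- Congruence on the left is therefore borrowed from the right through commutativity.
  *ₚ-cong : ∀ {p p′ q q′} → p ≈ₚ p′ → q ≈ₚ q′ → p *ₚ q ≈ₚ p′ *ₚ q′
  *ₚ-cong {p} {p′} {q} {q′} e e′ = P.trans (*ₚ-congˡ p e′)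
    (P.trans (*ₚ-comm p q′) (P.trans (*ₚ-congˡ q′ e) (*ₚ-comm q′ p′)))

  *ₚ-distribʳ : ∀ r p q → (p +ₚ q) *ₚ r ≈ₚ p *ₚ r +ₚ q *ₚ r
  *ₚ-distribʳ r []      q       = P.refl
  *ₚ-distribʳ r (a ∷ p) []      = P.sym (+ₚ-identityʳ _)
  *ₚ-distribʳ r (a ∷ p) (b ∷ q) = P.trans
    (+ₚ-cong (•-distribʳ a b r) (∷-cong refl (*ₚ-distribʳ r p q)))
    (P.sym (∷-interchange (a • r) (p *ₚ r) (b • r) (q *ₚ r)))

  *ₚ-distribˡ : ∀ r p q → r *ₚ (p +ₚ q) ≈ₚ r *ₚ p +ₚ r *ₚ q
  *ₚ-distribˡ r p q = P.trans (*ₚ-comm r (p +ₚ q))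
    (P.trans (*ₚ-distribʳ r p q) (+ₚ-cong (*ₚ-comm p r) (*ₚ-comm q r)))

  •-*ₚ : ∀ a p q → (a • p) *ₚ q ≈ₚ a • (p *ₚ q)
  •-*ₚ a []      q = P.refl
  •-*ₚ a (b ∷ p) q = P.trans
    (+ₚ-cong (•-assoc a b q) (∷-cong (sym (zeroʳ a)) (•-*ₚ a p q)))
    (P.sym (•-distribˡ a (b • q) (0# ∷ (p *ₚ q))))

  0∷-*ₚ : ∀ p q → (0# ∷ p) *ₚ q ≈ₚ 0# ∷ (p *ₚ q)
  0∷-*ₚ p q = +ₚ-cong (•-zero q refl) P.refl

  *ₚ-assoc : ∀ p q r → (p *ₚ q) *ₚ r ≈ₚ p *ₚ (q *ₚ r)
  *ₚ-assoc []      q r = P.refl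
  *ₚ-assoc (a ∷ p) q r = P.trans
    (*ₚ-distribʳ r (a • q) (0# ∷ (p *ₚ q)))
    (+ₚ-cong (•-*ₚ a q r) (P.trans (0∷-*ₚ (p *ₚ q) r) (∷-cong refl (*ₚ-assoc p q r))))

  *ₚ-identityˡ : ∀ p → const 1# *ₚ p ≈ₚ p
  *ₚ-identityˡ p = P.trans
    (+ₚ-cong {1# • p} {p} (mk≈ λ k → trans (coeff-• 1# p k) (*-identityˡ _)) 0∷[]≈[])
    (+ₚ-identityʳ p)

  -- Its raw ring is `polyRawRing` by definition, so the determinant in `charPoly` is literally a
  -- determinant over this ring.
  polynomialRing : CommutativeRing c (c ⊔ ℓ)
  polynomialRing = record
    { Carrier = Poly
    ; _≈_ = _≈ₚ_
    ; _+_ = _+ₚ_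
    ; _*_ = _*ₚ_
    ; -_ = -ₚ_
    ; 0# = []
    ; 1# = const 1#
    ; isCommutativeRing = record
      { isRing = record
        { +-isAbelianGroup = record
          { isGroup = record
            { isMonoid = record
              { isSemigroup = record
                { isMagma = record { isEquivalence = ≈ₚ-isEquivalence ; ∙-cong = +ₚ-cong }
                ; assoc = +ₚ-assoc
                }
              ; identity = (λ _ → P.refl) , +ₚ-identityʳ
              }
            ; inverse = (λ p → P.trans (+ₚ-comm (-ₚ p) p) (-ₚ-inverseʳ p)) , -ₚ-inverseʳ
            ; ⁻¹-cong = -ₚ-cong
            }
          ; comm = +ₚ-comm
          }
        ; *-cong = *ₚ-cong
        ; *-assoc = *ₚ-assoc
        ; *-identity = *ₚ-identityˡ , λ p → P.trans (*ₚ-comm p (const 1#)) (*ₚ-identityˡ p)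
        ; distrib = *ₚ-distribˡ , *ₚ-distribʳ
        }
      ; *-comm = *ₚ-comm
      }
    }

  const-isRingHomomorphism : IsRingHomomorphism rawRing polyRawRing const
  const-isRingHomomorphism = record
    { isSemiringHomomorphism = record
      { isNearSemiringHomomorphism = record
        { +-isMonoidHomomorphism = record
          { isMagmaHomomorphism = record
            { isRelHomomorphism = record { cong = λ a≈b → ∷-cong a≈b P.refl }
            ; homo = λ _ _ → P.refl
            }
          ; ε-homo = 0∷[]≈[]
          }
        ; *-homo = λ a b → ∷-cong (sym (+-identityʳ (a * b))) P.refl
        }
      ; 1#-homo = P.refl
      }
    ; -‿homo = λ _ → P.refl
    }

  private
    module PRᵖ = RingProperties (CommutativeRing.ring polynomialRing)

  linear : Carrier → Poly
  linear b = b ∷ 1# ∷ []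

  coeff-linear-* : ∀ b p k → coeff (linear b *ₚ p) (suc k) ≈ b * coeff p (suc k) + coeff p k
  coeff-linear-* b p k = trans (coeff-+ (b • p) _ (suc k))
    (+-cong (coeff-• b p (suc k)) (_≈ₚ_.coeff≈ (*ₚ-identityˡ p) k))

  -- The product's coefficients give `b * c (k+1) + c k = 0`. Beyond the end of the list all
  -- coefficients are zero, and the recurrence carries this downwards to the constant term without
  -- any division.
  linear-*-zero : ∀ b p → linear b *ₚ p ≈ₚ [] → p ≈ₚ []
  linear-*-zero b p (mk≈ e) = mk≈ (vanish p λ k → trans (sym (coeff-linear-* b p k)) (e (suc k)))
    where
    vanish : ∀ p → (∀ k → b * coeff p (suc k) + coeff p k ≈ 0#) → ∀ k → coeff p k ≈ 0#
    vanish []      _   _       = refl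
    vanish (a ∷ p) rec zero    = begin
      a                  ≈⟨ +-identityˡ a ⟨
      0# + a             ≈⟨ +-congʳ (zeroʳ b) ⟨
      b * 0# + a         ≈⟨ +-congʳ (*-congˡ (vanish p (λ k → rec (suc k)) 0)) ⟨
      b * coeff p 0 + a  ≈⟨ rec 0 ⟩
      0#                 ∎
      where open SetoidReasoning setoid
    vanish (a ∷ p) rec (suc k) = vanish p (λ k → rec (suc k)) k

  linear-*-cancelˡ : ∀ b p q → linear b *ₚ p ≈ₚ linear b *ₚ q → p ≈ₚ q
  linear-*-cancelˡ b p q e = PRᵖ.x∙y⁻¹≈ε⇒x≈y p q (linear-*-zero b (p -ₚ q)
    (P.trans (PRᵖ.x[y-z]≈xy-xz (linear b) p q) (PRᵖ.x≈y⇒x∙y⁻¹≈ε e)))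

-- Substitution into polynomials along a ring homomorphism

module Evaluation {c₁ ℓ₁ c₂ ℓ₂} (R : CommutativeRing c₁ ℓ₁) (K : CommutativeRing c₂ ℓ₂)
  {φ : CommutativeRing.Carrier R → CommutativeRing.Carrier K}
  (φ-hom : IsRingHomomorphism (CommutativeRing.rawRing R) (CommutativeRing.rawRing K) φ)
  (x : CommutativeRing.Carrier K) where
  open List using ([]; _∷_)
  private
    module R = CommutativeRing R
    module φ = IsRingHomomorphism φ-hom
  open CommutativeRing K hiding (zero)
  open Polynomial R.rawRing
  open PolynomialRing R using (_•_)
  open RingProperties ring using (-‿distribʳ-*; -0#≈0#; -‿+-comm)
  open SetoidReasoning setoid
  private
    module +ᵖ = CommutativeSemigroupProperties +-commutativeSemigroup
    module *ᵖ = CommutativeSemigroupProperties *-commutativeSemigroup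

  -- Horner's scheme. With `K` the polynomial ring and `φ` the embedding of constants, it
  -- substitutes the polynomial `x` for the variable.
  eval : Poly → Carrier
  eval []      = 0#
  eval (a ∷ p) = φ a + x * eval p

  -- Equal polynomials may be lists of different lengths; `eval-cong` disposes of the surplus zeros
  -- this way.
  eval-zero : ∀ p → p ≈ₚ [] → eval p ≈ 0#
  eval-zero []      _       = refl
  eval-zero (a ∷ p) (mk≈ e) = begin
    φ a + x * eval p  ≈⟨ +-cong (trans (φ.⟦⟧-cong (e 0)) φ.0#-homo)
                                (*-congˡ (eval-zero p (mk≈ λ k → e (suc k)))) ⟩
    0# + x * 0#       ≈⟨ trans (+-identityˡ _) (zeroʳ x) ⟩
    0#                ∎

  eval-cong : ∀ {p q} → p ≈ₚ q → eval p ≈ eval q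
  eval-cong {[]}    {q}     (mk≈ e) = sym (eval-zero q (mk≈ λ k → R.sym (e k)))
  eval-cong {a ∷ p} {[]}    e       = eval-zero (a ∷ p) e
  eval-cong {a ∷ p} {b ∷ q} (mk≈ e) =
    +-cong (φ.⟦⟧-cong (e 0)) (*-congˡ (eval-cong {p} {q} (mk≈ λ k → e (suc k))))

  eval-+ : ∀ p q → eval (p +ₚ q) ≈ eval p + eval q
  eval-+ []      q       = sym (+-identityˡ _)
  eval-+ (a ∷ p) []      = sym (+-identityʳ _)
  eval-+ (a ∷ p) (b ∷ q) = begin
    φ (a R.+ b) + x * eval (p +ₚ q)
      ≈⟨ +-cong (φ.+-homo a b) (trans (*-congˡ (eval-+ p q)) (distribˡ x _ _)) ⟩
    (φ a + φ b) + (x * eval p + x * eval q)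
      ≈⟨ +ᵖ.interchange _ _ _ _ ⟩
    (φ a + x * eval p) + (φ b + x * eval q) ∎

  eval-• : ∀ a p → eval (a • p) ≈ φ a * eval p
  eval-• a []      = sym (zeroʳ _)
  eval-• a (b ∷ p) = begin
    φ (a R.* b) + x * eval (a • p)
      ≈⟨ +-cong (φ.*-homo a b) (trans (*-congˡ (eval-• a p)) (*ᵖ.x∙yz≈y∙xz x _ _)) ⟩
    φ a * φ b + φ a * (x * eval p)
      ≈⟨ distribˡ _ _ _ ⟨
    φ a * (φ b + x * eval p) ∎

  eval-* : ∀ p q → eval (p *ₚ q) ≈ eval p * eval q
  eval-* []      q = sym (zeroˡ _)
  eval-* (a ∷ p) q = begin
    eval (a • q +ₚ (R.0# ∷ (p *ₚ q)))
      ≈⟨ eval-+ (a • q) (R.0# ∷ (p *ₚ q)) ⟩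
    eval (a • q) + (φ R.0# + x * eval (p *ₚ q))
      ≈⟨ +-cong (eval-• a q) (trans (+-congʳ φ.0#-homo) (+-identityˡ _)) ⟩
    φ a * eval q + x * eval (p *ₚ q)
      ≈⟨ +-congˡ (trans (*-congˡ (eval-* p q)) (sym (*-assoc x _ _))) ⟩
    φ a * eval q + x * eval p * eval q
      ≈⟨ distribʳ _ _ _ ⟨
    (φ a + x * eval p) * eval q ∎

  eval-neg : ∀ p → eval (-ₚ p) ≈ - eval p
  eval-neg []      = sym -0#≈0#
  eval-neg (a ∷ p) = trans
    (+-cong (φ.-‿homo a) (trans (*-congˡ (eval-neg p)) (sym (-‿distribʳ-* x _))))
    (-‿+-comm _ _)

  eval-const : ∀ a → eval (const a) ≈ φ a
  eval-const a = trans (+-congˡ (zeroʳ x)) (+-identityʳ _)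

  eval-X : eval X ≈ x
  eval-X = begin
    φ R.0# + x * eval (const R.1#)  ≈⟨ +-cong φ.0#-homo (*-congˡ (trans (eval-const R.1#) φ.1#-homo)) ⟩
    0# + x * 1#                     ≈⟨ trans (+-identityˡ _) (*-identityʳ x) ⟩
    x                               ∎

  eval-isRingHomomorphism : IsRingHomomorphism polyRawRing rawRing eval
  eval-isRingHomomorphism = record
    { isSemiringHomomorphism = record
      { isNearSemiringHomomorphism = record
        { +-isMonoidHomomorphism = record
          { isMagmaHomomorphism = record
            { isRelHomomorphism = record { cong = λ {p} {q} → eval-cong {p} {q} }
            ; homo = eval-+
            }
          ; ε-homo = refl
          }
        ; *-homo = eval-*
        }
      ; 1#-homo = trans (eval-const R.1#) φ.1#-homo
      }
    ; -‿homo = eval-neg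
    }

-- Determinants

open import Data.Vec.Functional using (Vector; _∷_; map)

private
  variable
    n : ℕ

punchIn-inject₁ : (j k : Fin n) → j ≤ k → punchIn (inject₁ j) k ≡ suc k
punchIn-inject₁ zero    k       _         = ≡.refl
punchIn-inject₁ (suc j) (suc k) (s≤s j≤k) = ≡.cong suc (punchIn-inject₁ j k j≤k)

punchIn-suc : (j k : Fin n) → j ≤ k → punchIn (suc k) j ≡ inject₁ j
punchIn-suc zero    k       _         = ≡.refl
punchIn-suc (suc j) (suc k) (s≤s j≤k) = ≡.cong suc (punchIn-suc j k j≤k)

-- The coface identity: deleting columns `j` and `k+1` leaves the same columns in the same order,
-- whichever goes first.
punchIn-comm : (j k : Fin (suc n)) → j ≤ k → ∀ l →
               punchIn (inject₁ j) (punchIn k l) ≡ punchIn (suc k) (punchIn j l)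
punchIn-comm zero    k       _         l       = ≡.refl
punchIn-comm (suc j) (suc k) (s≤s j≤k) zero    = ≡.refl
punchIn-comm {suc n} (suc j) (suc k) (s≤s j≤k) (suc l) = ≡.cong suc (punchIn-comm j k j≤k l)

module CommutativeRingIdentities {c ℓ} (K : CommutativeRing c ℓ) where
  open CommutativeRing K
  open RingProperties ring
  open SetoidReasoning setoid

  -- With `x` = Y this turns an entry of X I - A, evaluated at -Y and negated, into an entry of Y I
  -- + A.
  -1*[-xy-z] : ∀ x y z → - 1# * (- x * y - z) ≈ x * y + z
  -1*[-xy-z] x y z = begin
    - 1# * (- x * y - z)  ≈⟨ -1*x≈-x _ ⟩
    - (- x * y - z)       ≈⟨ -‿cong (+-congʳ (-‿distribˡ-* x y)) ⟨
    - (- (x * y) - z)     ≈⟨ -‿cong (-‿+-comm (x * y) z) ⟩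
    - (- (x * y + z))     ≈⟨ -‿involutive _ ⟩
    x * y + z             ∎

  x-w+[z+y+w] : ∀ x y z w → x - w + (z + y + w) ≈ x + y + z
  x-w+[z+y+w] x y z w = begin
    x - w + (z + y + w)        ≈⟨ +-congˡ (+-comm _ w) ⟩
    x - w + (w + (z + y))      ≈⟨ +-assoc x (- w) _ ⟩
    x + (- w + (w + (z + y)))  ≈⟨ +-congˡ (\\-leftDividesʳ w _) ⟩
    x + (z + y)                ≈⟨ +-congˡ (+-comm z y) ⟩
    x + (y + z)                ≈⟨ +-assoc x y z ⟨
    x + y + z                  ∎

module Determinant {c ℓ} (K : CommutativeRing c ℓ) where
  open CommutativeRing K hiding (zero)
  open LinearAlgebra rawRing
  open RawSemiringDefinitions (RawRing.rawSemiring rawRing) using (_^_)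
  open SemiringSum semiring
  open CommutativeMonoidSum *-commutativeMonoid using ()
    renaming ( sum to product; sum-cong-≋ to product-cong
             ; ∑-distrib-+ to product-distrib-*; sum-replicate to product-replicate)
  open MonoidMult +-monoid using (_×_)
  open RingProperties ring using
    (-‿distribˡ-*; -1*x≈-x; -0#≈0#; +-inverseˡ-unique; +-cancelʳ)
  open SetoidReasoning setoid
  private
    module *ᵖ = CommutativeSemigroupProperties *-commutativeSemigroup

  sum-cong : (f g : Vector Carrier n) → (∀ i → f i ≈ g i) → sum f ≈ sum g
  sum-cong f g f≈g = sum-cong-≋ f≈g

  sum-zero : (f : Vector Carrier n) → (∀ i → f i ≈ 0#) → sum f ≈ 0#
  sum-zero {n} f f≈0 = trans (sum-cong-≋ f≈0) (sum-replicate-zero n)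

  minors : (Fin n → Vector Carrier (suc n)) → Fin (suc n) → Matrix Carrier n
  minors B j i k = B i (punchIn j k)

  -- det (v ∷ B) is by definition the sum of laplace v B.
  laplace : Vector Carrier (suc n) → (Fin n → Vector Carrier (suc n)) → Vector Carrier (suc n)
  laplace v B j = (- 1#) ^ toℕ j * v j * det (minors B j)

  det-cong : (M N : Matrix Carrier n) → (∀ i j → M i j ≈ N i j) → det M ≈ det N
  det-cong {zero}  M N M≈N = refl
  det-cong {suc n} M N M≈N = sum-cong (laplace (M zero) (M ∘ suc)) (laplace (N zero) (N ∘ suc)) λ j →
    *-cong (*-congˡ (M≈N zero j)) (det-cong _ _ λ i k → M≈N (suc i) (punchIn j k))

  det-cong₀ : (u v : Vector Carrier (suc n)) (B : Fin n → Vector Carrier (suc n)) →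
              (∀ j → u j ≈ v j) → det (u ∷ B) ≈ det (v ∷ B)
  det-cong₀ u v B u≈v = sum-cong (laplace u B) (laplace v B) λ j → *-congʳ (*-congˡ (u≈v j))

  -- Only the determinants of the minors are compared, not their entries, so that row operations
  -- below the first row can be carried out inside the minors by induction.
  det-cong-minors : (v : Vector Carrier (suc n)) (B C : Fin n → Vector Carrier (suc n)) →
    (∀ j → det (minors B j) ≈ det (minors C j)) → det (v ∷ B) ≈ det (v ∷ C)
  det-cong-minors v B C B≈C = sum-cong (laplace v B) (laplace v C) λ j → *-congˡ (B≈C j)

  det-zero₀ : (B : Fin n → Vector Carrier (suc n)) → det ((λ _ → 0#) ∷ B) ≈ 0#
  det-zero₀ B = sum-zero (laplace (λ _ → 0#) B) λ j → trans (*-congʳ (zeroʳ _)) (zeroˡ _)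

  det-+ : (u v : Vector Carrier (suc n)) (B : Fin n → Vector Carrier (suc n)) →
          det ((λ j → u j + v j) ∷ B) ≈ det (u ∷ B) + det (v ∷ B)
  det-+ u v B = trans
    (sum-cong (laplace (λ j → u j + v j) B) (λ j → laplace u B j + laplace v B j) λ j →
      trans (*-congʳ (distribˡ _ (u j) (v j))) (distribʳ _ _ _))
    (∑-distrib-+ (laplace u B) (laplace v B))

  det-* : ∀ a (v : Vector Carrier (suc n)) (B : Fin n → Vector Carrier (suc n)) →
          det ((λ j → a * v j) ∷ B) ≈ a * det (v ∷ B)
  det-* a v B = trans
    (sum-cong (laplace (λ j → a * v j) B) (λ j → a * laplace v B j) λ j →
      trans (*-congʳ (*ᵖ.x∙yz≈y∙xz _ a (v j))) (*-assoc a _ _))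
    (sym (*-distribˡ-sum a (laplace v B)))

  det-sum : ∀ {m} (V : Fin m → Vector Carrier (suc n)) (B : Fin n → Vector Carrier (suc n)) →
            det ((λ j → sum λ i → V i j) ∷ B) ≈ sum λ i → det (V i ∷ B)
  det-sum {m = zero}  V B = det-zero₀ B
  det-sum {m = suc m} V B = trans
    (det-+ (V zero) (λ j → sum λ i → V (suc i) j) B)
    (+-congˡ (det-sum (V ∘ suc) B))

  -- The second row of the matrix is the first row of every minor, where `det-+` applies.
  det-+₁ : (u v w : Vector Carrier (suc (suc n))) (C : Fin n → Vector Carrier (suc (suc n))) →
           det (u ∷ (λ j → v j + w j) ∷ C) ≈ det (u ∷ v ∷ C) + det (u ∷ w ∷ C)
  det-+₁ u v w C = trans
    (sum-cong (laplace u ((λ j → v j + w j) ∷ C)) (λ j → laplace u (v ∷ C) j + laplace u (w ∷ C) j) λ j →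
      trans (*-congˡ (det-+ (v ∘ punchIn j) (w ∘ punchIn j) (λ i → C i ∘ punchIn j)))
            (distribˡ _ _ _))
    (∑-distrib-+ (laplace u (v ∷ C)) (laplace u (w ∷ C)))

  -- The pairs (j , k) with k : Fin n stand for the ordered pairs of distinct
  -- columns j and punchIn j k; for j ≤ k the pairs (inject₁ j , k) and
  -- (suc k , j) are transposes of each other.
  sum-antisymmetric : (g : Fin (suc n) → Fin n → Carrier) →
    (∀ j k → j ≤ k → g (inject₁ j) k + g (suc k) j ≈ 0#) →
    (sum λ j → sum (g j)) ≈ 0#
  sum-antisymmetric {zero}  g anti = +-identityˡ 0#
  sum-antisymmetric {suc n} g anti = begin
    sum (g zero) + (sum λ j → g (suc j) zero + sum (g (suc j) ∘ suc))
      ≈⟨ +-congˡ (∑-distrib-+ (λ j → g (suc j) zero) (λ j → sum (g (suc j) ∘ suc))) ⟩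
    sum (g zero) + (sum (λ j → g (suc j) zero) + sum (λ j → sum (g (suc j) ∘ suc)))
      ≈⟨ +-assoc _ _ _ ⟨
    sum (g zero) + sum (λ j → g (suc j) zero) + sum (λ j → sum (g (suc j) ∘ suc))
      ≈⟨ +-cong (∑-distrib-+ (g zero) (λ j → g (suc j) zero)) refl ⟨
    sum (λ j → g zero j + g (suc j) zero) + sum (λ j → sum (g (suc j) ∘ suc))
      ≈⟨ +-cong (sum-zero (λ j → g zero j + g (suc j) zero) λ j → anti zero j z≤n)
                (sum-antisymmetric (λ j k → g (suc j) (suc k))
                  λ j k j≤k → anti (suc j) (suc k) (s≤s j≤k)) ⟩
    0# + 0#
      ≈⟨ +-identityˡ 0# ⟩
    0# ∎

  -- Expanding along both rows gives a sum over ordered pairs of distinct columns, in which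
  -- transposed pairs cancel. Vanishing is proved before antisymmetry because the latter would yield
  -- only that twice the determinant is zero.
  det-alternating₀₁ : (v : Vector Carrier (suc (suc n))) (C : Fin n → Vector Carrier (suc (suc n))) →
                      det (v ∷ v ∷ C) ≈ 0#
  det-alternating₀₁ {n} v C = trans
    (sum-cong (laplace v (v ∷ C)) (λ j → sum λ k → ε j * v j * term j k) λ j →
      *-distribˡ-sum (ε j * v j) (term j))
    (sum-antisymmetric (λ j k → ε j * v j * term j k) anti)
    where
    ε : ∀ {m} → Fin m → Carrier
    ε j = (- 1#) ^ toℕ j

    term : Fin (suc (suc n)) → Fin (suc n) → Carrier
    term j = laplace (v ∘ punchIn j) (λ i → C i ∘ punchIn j)

    anti : ∀ j k → j ≤ k →
           ε (inject₁ j) * v (inject₁ j) * term (inject₁ j) k + ε (suc k) * v (suc k) * term (suc k) j ≈ 0#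
    anti j k j≤k = begin
      ε (inject₁ j) * v (inject₁ j) * term (inject₁ j) k + ε (suc k) * v (suc k) * term (suc k) j
        ≈⟨ +-cong
             (*-cong
               (*-congʳ (reflexive (≡.cong ((- 1#) ^_) (toℕ-inject₁ j))))
               (*-congʳ (*-congˡ (reflexive (≡.cong v (punchIn-inject₁ j k j≤k))))))
             (*-cong
               -- Column `k+1` has position `k+1` in the full matrix but `k` once column `j` is
               -- gone; column `j` keeps its position. This single sign makes the two terms
               -- opposite.
               (trans (*-assoc _ _ _) (-1*x≈-x _))
               (*-cong (*-congˡ (reflexive (≡.cong v (punchIn-suc j k j≤k))))
                 (det-cong _ _ λ i l → reflexive (≡.cong (C i) (≡.sym (punchIn-comm j k j≤k l)))))) ⟩
      x * (y * d) + - y * (x * d)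
        ≈⟨ +-cong (*ᵖ.x∙yz≈y∙xz x y d) (sym (-‿distribˡ-* y (x * d))) ⟩
      y * (x * d) + - (y * (x * d))
        ≈⟨ -‿inverseʳ _ ⟩
      0# ∎
      where
      x = ε j * v (inject₁ j)
      y = ε k * v (suc k)
      d = det (λ i l → C i (punchIn (inject₁ j) (punchIn k l)))

  -- Polarisation: the determinant with `u + v` in both rows vanishes, and of its four terms the two
  -- with equal rows vanish too.
  det-swap₀₁ : (u v : Vector Carrier (suc (suc n))) (C : Fin n → Vector Carrier (suc (suc n))) →
               det (u ∷ v ∷ C) ≈ - det (v ∷ u ∷ C)
  det-swap₀₁ u v C = +-inverseˡ-unique _ _ (begin
    det (u ∷ v ∷ C) + det (v ∷ u ∷ C)
      ≈⟨ +-cong (+-identityˡ _) (+-identityʳ _) ⟨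
    (0# + det (u ∷ v ∷ C)) + (det (v ∷ u ∷ C) + 0#)
      ≈⟨ +-cong (+-congʳ (det-alternating₀₁ u C)) (+-congˡ (det-alternating₀₁ v C)) ⟨
    (det (u ∷ u ∷ C) + det (u ∷ v ∷ C)) + (det (v ∷ u ∷ C) + det (v ∷ v ∷ C))
      ≈⟨ +-cong (det-+₁ u u v C) (det-+₁ v u v C) ⟨
    det (u ∷ w ∷ C) + det (v ∷ w ∷ C)
      ≈⟨ det-+ u v (w ∷ C) ⟨
    det (w ∷ w ∷ C)
      ≈⟨ det-alternating₀₁ w C ⟩
    0# ∎)
    where
    w = λ j → u j + v j

  -- Swapping the first two rows moves the claim to the minors.
  det-repeated : (B : Fin n → Vector Carrier (suc n)) (i : Fin n) → det (B i ∷ B) ≈ 0#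
  det-repeated B zero = det-alternating₀₁ (B zero) (B ∘ suc)
  det-repeated {suc n} B (suc i) = begin
    det (v ∷ b ∷ C)
      ≈⟨ det-swap₀₁ v b C ⟩
    - det (b ∷ v ∷ C)
      ≈⟨ -‿cong (sum-zero (laplace b (v ∷ C)) λ j → trans
           (*-congˡ (det-repeated (λ i → C i ∘ punchIn j) i)) (zeroʳ _)) ⟩
    - 0#
      ≈⟨ -0#≈0# ⟩
    0# ∎
    where
    b = B zero
    C = B ∘ suc
    v = C i

  -- Alternation clears the second row. After a swap `v` heads every minor, so the rows below are
  -- cleared by induction, and a second swap restores the order.
  det-add-row₀ : (v : Vector Carrier (suc n)) (B : Fin n → Vector Carrier (suc n)) →
                 det (v ∷ λ i j → B i j + v j) ≈ det (v ∷ B)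
  det-add-row₀ {zero}  v B = refl
  det-add-row₀ {suc n} v B = begin
    det (v ∷ (λ j → b j + v j) ∷ C+v)
      ≈⟨ det-+₁ v b v C+v ⟩
    det (v ∷ b ∷ C+v) + det (v ∷ v ∷ C+v)
      ≈⟨ +-congˡ (det-alternating₀₁ v C+v) ⟩
    det (v ∷ b ∷ C+v) + 0#
      ≈⟨ +-identityʳ _ ⟩
    det (v ∷ b ∷ C+v)
      ≈⟨ det-swap₀₁ v b C+v ⟩
    - det (b ∷ v ∷ C+v)
      ≈⟨ -‿cong (det-cong-minors b (v ∷ C+v) (v ∷ C) λ j →
           det-add-row₀ (v ∘ punchIn j) (λ i → C i ∘ punchIn j)) ⟩
    - det (b ∷ v ∷ C)
      ≈⟨ det-swap₀₁ v b C ⟨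
    det (v ∷ b ∷ C) ∎
    where
    b   = B zero
    C   = B ∘ suc
    C+v = λ i j → C i j + v j

  -- Alternation lets the first row be replaced by the sum of all rows.
  det-column-sums : ∀ s (M : Matrix Carrier (suc n)) → (∀ j → (sum λ i → M i j) ≈ s) →
                    det M ≈ s * det ((λ _ → 1#) ∷ M ∘ suc)
  det-column-sums s M colsum = begin
    det M
      ≈⟨ +-identityʳ _ ⟨
    det M + 0#
      ≈⟨ +-congˡ (sum-zero (λ i → det (M (suc i) ∷ B)) (det-repeated B)) ⟨
    sum (λ i → det (M i ∷ B))
      ≈⟨ det-sum M B ⟨
    det ((λ j → sum λ i → M i j) ∷ B)
      ≈⟨ det-cong₀ (λ j → sum λ i → M i j) (λ _ → s * 1#) B
           (λ j → trans (colsum j) (sym (*-identityʳ s))) ⟩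
    det ((λ _ → s * 1#) ∷ B)
      ≈⟨ det-* s (λ _ → 1#) B ⟩
    s * det ((λ _ → 1#) ∷ B) ∎
    where
    B = M ∘ suc

  det-scale : ∀ a (M : Matrix Carrier n) → det (λ i j → a * M i j) ≈ a ^ n * det M
  det-scale {zero}  a M = sym (*-identityˡ 1#)
  det-scale {suc n} a M = begin
    det ((λ j → a * M zero j) ∷ aB)
      ≈⟨ det-* a (M zero) aB ⟩
    a * det (M zero ∷ aB)
      ≈⟨ *-congˡ (sum-cong (laplace (M zero) aB) (λ j → a ^ n * laplace (M zero) B j) λ j →
           trans (*-congˡ (det-scale a (minors B j))) (*ᵖ.x∙yz≈y∙xz _ _ _)) ⟩
    a * sum (λ j → a ^ n * laplace (M zero) B j)
      ≈⟨ *-congˡ (*-distribˡ-sum (a ^ n) (laplace (M zero) B)) ⟨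
    a * (a ^ n * det M)
      ≈⟨ *-assoc _ _ _ ⟨
    a ^ suc n * det M ∎
    where
    B  = M ∘ suc
    aB = λ i j → a * B i j

  sum-identity : (j : Fin n) → (sum λ i → identity i j) ≈ 1#
  sum-identity {suc n} zero    = trans (+-congˡ (sum-replicate-zero n)) (+-identityʳ 1#)
  sum-identity         (suc j) = trans (+-identityˡ _) (sum-identity j)

  column-sums-shift : ∀ y s (M : Matrix Carrier n) → (∀ j → (sum λ i → M i j) ≈ s) →
                      ∀ j → (sum λ i → y * identity i j + M i j) ≈ y + s
  column-sums-shift y s M colsum j = trans
    (∑-distrib-+ (λ i → y * identity i j) (λ i → M i j))
    (+-cong (trans (sym (*-distribˡ-sum y (λ i → identity i j)))
              (trans (*-congˡ (sum-identity j)) (*-identityʳ y)))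
            (colsum j))

  -- Here `t` is the common column sum of `T`, that is `s` minus the order. Writing this as a sum
  -- lets the order be cancelled from both sides.
  det-minus-ones : ∀ s t (T N : Matrix Carrier (suc n)) → (∀ i j → T i j + 1# ≈ N i j) →
                   (∀ j → (sum λ i → N i j) ≈ s) → t + suc n × 1# ≈ s →
                   det T ≈ t * det ((λ _ → 1#) ∷ N ∘ suc)
  det-minus-ones {n} s t T N T+1≈N colsum t+n≈s = begin
    det T
      ≈⟨ det-column-sums t T (λ j → +-cancelʳ (suc n × 1#) _ t (begin
           sum (λ i → T i j) + suc n × 1#
             ≈⟨ +-congˡ (sum-replicate (suc n)) ⟨
           sum (λ i → T i j) + sum ones
             ≈⟨ ∑-distrib-+ (λ i → T i j) ones ⟨
           sum (λ i → T i j + 1#)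
             ≈⟨ sum-cong (λ i → T i j + 1#) (λ i → N i j) (λ i → T+1≈N i j) ⟩
           sum (λ i → N i j)
             ≈⟨ trans (colsum j) (sym t+n≈s) ⟩
           t + suc n × 1# ∎)) ⟩
    t * det (ones ∷ T ∘ suc)
      ≈⟨ *-congˡ (det-add-row₀ ones (T ∘ suc)) ⟨
    t * det (ones ∷ T+1)
      ≈⟨ *-congˡ (det-cong-minors ones T+1 (N ∘ suc) λ j →
           det-cong _ _ λ i k → T+1≈N (suc i) (punchIn j k)) ⟩
    t * det (ones ∷ N ∘ suc) ∎
    where
    ones : Vector Carrier (suc n)
    ones _ = 1#
    T+1 : Fin n → Vector Carrier (suc n)
    T+1 i j = T (suc i) j + 1#

  product-scale : ∀ a (f : Vector Carrier n) → product (λ i → a * f i) ≈ a ^ n * product f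
  product-scale {n} a f = trans (product-distrib-* (λ _ → a) f) (*-congʳ (product-replicate n))

  -- An n by n determinant and a product of n factors both acquire the factor `a ^ n`. With `a` = -1
  -- the global sign is thus absorbed into entries and factors.
  det-product-scale : ∀ a (P : Matrix Carrier n) (ρ : Vector Carrier n) → det P ≈ product ρ →
                      det (λ i j → a * P i j) ≈ product (λ i → a * ρ i)
  det-product-scale a P ρ det≈ =
    trans (det-scale a P) (trans (*-congˡ det≈) (sym (product-scale a ρ)))

  det-product-cong : (P Q : Matrix Carrier n) (ρ τ : Vector Carrier n) →
                     (∀ i j → P i j ≈ Q i j) → (∀ i → ρ i ≈ τ i) →
                     det P ≈ product ρ → det Q ≈ product τ
  det-product-cong P Q ρ τ P≈Q ρ≈τ det≈ =
    trans (sym (det-cong P Q P≈Q)) (trans det≈ (product-cong ρ≈τ))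

-- Homomorphisms preserve sums, multiples and determinants

module _ {c₁ ℓ₁ c₂ ℓ₂} (M : Monoid c₁ ℓ₁) (N : Monoid c₂ ℓ₂)
  {f : Monoid.Carrier M → Monoid.Carrier N}
  (f-hom : IsMonoidHomomorphism (Monoid.rawMonoid M) (Monoid.rawMonoid N) f) where
  private
    module M = Monoid M
    module N = Monoid N
    module MS = MonoidSum M
    module NS = MonoidSum N
    module MM = MonoidMult M
    module NM = MonoidMult N
  open IsMonoidHomomorphism f-hom

  -- Stated for monoids so that the multiplicative monoid of a ring is covered as well: there `sum`
  -- is a product, and the multiples in `×-homo` are powers.
  sum-homo : (v : Vector M.Carrier n) → f (MS.sum v) N.≈ NS.sum (f ∘ v)
  sum-homo {zero}  v = ε-homo
  sum-homo {suc n} v = N.trans (homo _ _) (N.∙-congˡ (sum-homo (v ∘ suc)))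

  ×-homo : ∀ k a → f (k MM.× a) N.≈ k NM.× f a
  ×-homo zero    a = ε-homo
  ×-homo (suc k) a = N.trans (homo _ _) (N.∙-congˡ (×-homo k a))

module _ {c₁ ℓ₁ c₂ ℓ₂} (K : CommutativeRing c₁ ℓ₁) (L : CommutativeRing c₂ ℓ₂)
  {f : CommutativeRing.Carrier K → CommutativeRing.Carrier L}
  (f-hom : IsRingHomomorphism (CommutativeRing.rawRing K) (CommutativeRing.rawRing L) f) where
  private
    module K = CommutativeRing K
    module L = CommutativeRing L
    module KA = LinearAlgebra K.rawRing
    module LA = LinearAlgebra L.rawRing
    module KP = CommutativeMonoidSum K.*-commutativeMonoid
    module LP = CommutativeMonoidSum L.*-commutativeMonoid
    module KM = MonoidMult K.*-monoid
    module LM = MonoidMult L.*-monoid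
    module KD = Determinant K
    module LD = Determinant L
  open IsRingHomomorphism f-hom

  det-homo : (M : Matrix K.Carrier n) → f (KA.det M) L.≈ LA.det (λ i j → f (M i j))
  det-homo {zero}  M = 1#-homo
  det-homo {suc n} M = L.trans
    (sum-homo K.+-monoid L.+-monoid +-isMonoidHomomorphism (KD.laplace (M zero) (M ∘ suc)))
    (LD.sum-cong _ (LD.laplace (f ∘ M zero) (λ i → f ∘ M (suc i))) λ j →
      L.trans (*-homo _ _) (L.*-cong
        (L.trans (*-homo _ _) (L.*-congʳ (sign-homo (toℕ j))))
        (det-homo (KD.minors (M ∘ suc) j))))
    where
    sign-homo : ∀ k → f (k KM.× (K.- K.1#)) L.≈ k LM.× (L.- L.1#)
    sign-homo k = L.trans (×-homo K.*-monoid L.*-monoid *-isMonoidHomomorphism k (K.- K.1#))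
      (LM.×-congʳ k (L.trans (-‿homo K.1#) (L.-‿cong 1#-homo)))

  det-product-homo : (P : Matrix K.Carrier n) (ρ : Vector K.Carrier n) →
                     KA.det P K.≈ KP.sum ρ →
                     LA.det (λ i j → f (P i j)) L.≈ LP.sum (f ∘ ρ)
  det-product-homo P ρ det≈ = L.trans (L.sym (det-homo P))
    (L.trans (⟦⟧-cong det≈) (sum-homo K.*-monoid L.*-monoid *-isMonoidHomomorphism ρ))

-- Spectra of complements

identityℕ : Fin n → Fin n → ℕ
identityℕ i j = if does (i ≟ j) then 1 else 0

-- The subtraction-free form of `complement-adjacency`. As an equation in ℕ it passes to every
-- commutative ring under `_× 1#`.
adjacency-complementary : (D : Digraph n) (i j : Fin n) →
  adjacency D i j ℕ.+ δ (σ D) ℕ.* identityℕ i j ℕ.+ adjacency (complement D) i j ≡ 1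
adjacency-complementary D i j = ℤ.+-injective (begin
  + (a ℕ.+ d ℕ.* e ℕ.+ b)
    ≡⟨ ≡.trans (ℤ.pos-+ (a ℕ.+ d ℕ.* e) b) (≡.cong (ℤ._+ + b)
         (≡.trans (ℤ.pos-+ a (d ℕ.* e)) (≡.cong (ℤ._+_ (+ a)) (ℤ.pos-* d e)))) ⟩
  + a ℤ.+ + d ℤ.* + e ℤ.+ + b
    ≡⟨ ≡.cong (ℤ._+_ (+ a ℤ.+ + d ℤ.* + e)) (complement-adjacency D i j) ⟩
  + a ℤ.+ + d ℤ.* + e ℤ.+ (ℤ.1ℤ ℤ.- + d ℤ.* identityℤ i j ℤ.- + a)
    ≡⟨ ≡.cong (λ z → + a ℤ.+ + d ℤ.* + e ℤ.+ (ℤ.1ℤ ℤ.- + d ℤ.* z ℤ.- + a))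
         (if-float +_ (does (i ≟ j))) ⟨
  + a ℤ.+ + d ℤ.* + e ℤ.+ (ℤ.1ℤ ℤ.- + d ℤ.* + e ℤ.- + a)
    ≡⟨ solve 2 (λ x y → x :+ y :+ (con ℤ.1ℤ :- y :- x) := con ℤ.1ℤ) ≡.refl (+ a) (+ d ℤ.* + e) ⟩
  ℤ.1ℤ ∎)
  where
  open ≡.≡-Reasoning
  open +-*-Solver
  open LinearAlgebra ℤ.+-*-rawRing using () renaming (identity to identityℤ)
  a = adjacency D i j
  b = adjacency (complement D) i j
  d = δ (σ D)
  e = identityℕ i j

module ComplementSpectrum {c ℓ} (R : CommutativeRing c ℓ) where
  private
    module R where
      open CommutativeRing R public
      open RingProperties ring public
        using (-‿involutive; -‿+-comm; \\-leftDividesʳ; //-rightDividesˡ)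
      open SemiringSum semiring public using (sum)
      open SemiringMult semiring public using (_×_)
      open LinearAlgebra rawRing public using (identity)
  open Polynomial R.rawRing
  open PolynomialRing R
  open Spectrum R.rawRing renaming (HasEigenvalues to HasEigenvaluesᴿ)
  open CommutativeRing polynomialRing hiding (zero)
  open MonoidMult +-monoid using (_×_)
  open CommutativeMonoidSum *-commutativeMonoid using ()
    renaming (sum to product; sum-cong-≋ to product-cong)
  open LinearAlgebra rawRing using (det; identity)
  open Determinant polynomialRing
  open CommutativeRingIdentities polynomialRing
  open SetoidReasoning setoid
  private
    module C = IsRingHomomorphism const-isRingHomomorphism

  const-identity : (i j : Fin n) → const (R.identity i j) ≈ identity i j
  const-identity i j with does (i ≟ j)
  ... | true  = refl
  ... | false = C.0#-homo

  module _ (Y : Poly) where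
    open Evaluation R polynomialRing const-isRingHomomorphism (- Y)
    private
      module E = IsRingHomomorphism eval-isRingHomomorphism

    eval-identity : (i j : Fin n) → eval (identity i j) ≈ identity i j
    eval-identity i j with does (i ≟ j)
    ... | true  = E.1#-homo
    ... | false = refl

    -- One computation for both sides of the factorisation: `p` is an entry of the identity matrix
    -- for the determinant, and `1#` for the linear factors.
    neg-eval : ∀ a p b → eval a ≈ - Y * p → - 1# * eval (a - const b) ≈ Y * p + const b
    neg-eval a p b eval-a = begin
      - 1# * eval (a - const b)
        ≈⟨ *ₚ-congˡ (- 1#) (trans (E.+-homo a (- const b))
             (+ₚ-cong eval-a (trans (E.-‿homo (const b)) (-ₚ-cong (eval-const b))))) ⟩
      - 1# * (- Y * p - const b)
        ≈⟨ -1*[-xy-z] Y p (const b) ⟩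
      Y * p + const b ∎

    -- The factorisation of det (X I - M), evaluated at X = - Y.
    det-shift : (M : Matrix R.Carrier n) (ν : Vector R.Carrier n) → HasEigenvaluesᴿ M ν →
                det (λ i j → Y * identity i j + const (M i j)) ≈ product λ i → Y + const (ν i)
    det-shift M ν eigen = det-product-cong (λ i j → - 1# * eval (P i j)) _ (λ i → - 1# * eval (ρ i)) _
      (λ i j → neg-eval (X * identity i j) (identity i j) (M i j)
        (trans (E.*-homo X (identity i j)) (*ₚ-cong eval-X (eval-identity i j))))
      (λ i → trans
        (neg-eval X 1# (ν i) (trans eval-X (sym (*-identityʳ (- Y)))))
        (+ₚ-cong (*-identityʳ Y) refl))
      (det-product-scale (- 1#) (λ i j → eval (P i j)) (λ i → eval (ρ i))
        (det-product-homo polynomialRing polynomialRing eval-isRingHomomorphism P ρ eigen))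
      where
      P = λ i j → X * identity i j - const (M i j)
      ρ = λ i → X - const (ν i)

  -- The digraph is reduced to two facts about matrices: `M + d I + M′ = J` entrywise, and constant
  -- column sums of `M`. The scalar `d` may be any ring element.
  eigenvalues-complement : ∀ {m} (M M′ : Matrix R.Carrier (suc m)) (r d : R.Carrier) →
    (∀ i j → M i j R.+ d R.* R.identity i j R.+ M′ i j R.≈ R.1#) →
    (∀ j → R.sum (λ i → M i j) R.≈ r) →
    (μ : Vector R.Carrier m) →
    HasEigenvaluesᴿ M (r ∷ μ) →
    HasEigenvaluesᴿ M′ ((suc m R.× R.1# R.- r R.- d) ∷ map (λ z → R.- d R.- z) μ)
  eigenvalues-complement {m} M M′ r d complementary colsum μ eigen = begin
    det T
      ≈⟨ det-minus-ones (Y + const r) t T N T+1≈N colsum-N t+n≈Y+r ⟩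
    t * det (ones ∷ N ∘ suc)
      ≈⟨ *ₚ-congˡ t det-ones∷N ⟩
    t * product (λ i → Y + const (μ i))
      ≈⟨ *ₚ-congˡ t (product-cong {m} λ i → X-[-d-z] (μ i)) ⟨
    t * product (λ i → X - const (R.- d R.- μ i)) ∎
    where
    Y = X + const d
    N T : Matrix Poly (suc m)
    N i j = Y * identity i j + const (M i j)
    T i j = X * identity i j - const (M′ i j)
    ones : Vector Poly (suc m)
    ones _ = 1#
    -- Summing `M + d I + M′ = J` down a column shows that `ν` is the column sum of `M′`; hence `t`
    -- is that of `T`.
    ν = suc m R.× R.1# R.- r R.- d
    t = X - const ν

    colsum-N = column-sums-shift Y (const r) (λ i j → const (M i j)) λ j → trans
      (sym (sum-homo R.+-monoid +-monoid C.+-isMonoidHomomorphism (λ i → M i j)))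
      (C.⟦⟧-cong (colsum j))

    det-ones∷N : det (ones ∷ N ∘ suc) ≈ product λ i → Y + const (μ i)
    -- `Y + const r` computes to the list `linear (0# + d + r)`, which exhibits it as monic of
    -- degree one.
    det-ones∷N = linear-*-cancelˡ (R.0# R.+ d R.+ r) _ _ (begin
      (Y + const r) * det (ones ∷ N ∘ suc)
        ≈⟨ det-column-sums (Y + const r) N colsum-N ⟨
      det N
        ≈⟨ det-shift Y M (r ∷ μ) eigen ⟩
      (Y + const r) * product (λ i → Y + const (μ i)) ∎)

    X-[-d-z] : ∀ z → X - const (R.- d R.- z) ≈ Y + const z
    X-[-d-z] z = ∷-cong (R.trans
      (R.+-congˡ (R.trans (R.-‿cong (R.-‿+-comm d z)) (R.-‿involutive _)))
      (R.sym (R.+-assoc _ _ _))) refl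

    T+1≈N : ∀ i j → T i j + 1# ≈ N i j
    T+1≈N i j = begin
      X * identity i j - const (M′ i j) + 1#
        ≈⟨ +ₚ-cong {X * identity i j - const (M′ i j)} refl (C.⟦⟧-cong (complementary i j)) ⟨
      X * identity i j - const (M′ i j) + (const (M i j) + const (d R.* R.identity i j) + const (M′ i j))
        ≈⟨ x-w+[z+y+w] (X * identity i j) (const (d R.* R.identity i j)) (const (M i j)) (const (M′ i j)) ⟩
      X * identity i j + const (d R.* R.identity i j) + const (M i j)
        ≈⟨ +ₚ-cong (+ₚ-cong {X * identity i j} refl
             (trans (C.*-homo d (R.identity i j)) (*ₚ-congˡ (const d) (const-identity i j)))) refl ⟩
      X * identity i j + const d * identity i j + const (M i j)
        ≈⟨ +ₚ-cong (distribʳ (identity i j) X (const d)) refl ⟨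
      Y * identity i j + const (M i j) ∎

    ν+d+r≈n : ν R.+ (d R.+ r) R.≈ suc m R.× R.1#
    ν+d+r≈n = R.trans (R.sym (R.+-assoc ν d r))
      (R.trans (R.+-congʳ (R.//-rightDividesˡ d _)) (R.//-rightDividesˡ r _))

    -ν+n≈d+r : R.- ν R.+ suc m R.× R.1# R.≈ d R.+ r
    -ν+n≈d+r = R.trans (R.+-congˡ (R.sym ν+d+r≈n)) (R.\\-leftDividesʳ ν (d R.+ r))

    t+n≈Y+r : t + suc m × 1# ≈ Y + const r
    t+n≈Y+r = begin
      t + suc m × 1#
        ≈⟨ +ₚ-cong {t} refl (×-homo R.+-monoid +-monoid C.+-isMonoidHomomorphism (suc m) R.1#) ⟨
      linear (R.0# R.- ν R.+ suc m R.× R.1#)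
        ≈⟨ ∷-cong (R.trans (R.+-congʳ (R.+-identityˡ _)) (R.trans -ν+n≈d+r
             (R.sym (R.+-congʳ (R.+-identityˡ d))))) refl ⟩
      Y + const r ∎

-- Transfer from natural-number matrices of digraphs to a ring

module DigraphSpectrum {c ℓ} (R : CommutativeRing c ℓ) where
  open CommutativeRing R hiding (zero)
  open SemiringSum semiring using (sum)
  open SemiringMult semiring using (_×_; ×-congˡ; ×-homo-+; ×1-homo-*)
  open LinearAlgebra rawRing using (identity)
  open Spectrum rawRing renaming (HasEigenvalues to HasEigenvaluesᴿ)
  open ComplementSpectrum using (eigenvalues-complement)
  open SetoidReasoning setoid

  natural-identity : (i j : Fin n) → identityℕ i j × 1# ≈ identity i j
  natural-identity i j with does (i ≟ j)
  ... | true  = +-identityʳ 1#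
  ... | false = refl

  -- Since `fromℕ k` unfolds to `k × 1#`, the complex statement is an instance of this one by
  -- definition.
  eigenvalues-complement-digraph : ∀ {m} (D : Digraph (suc m)) (r : ℕ) → Regular r D →
    (μ : Vector Carrier m) →
    HasEigenvaluesᴿ (λ i j → adjacency D i j × 1#) (r × 1# ∷ μ) →
    HasEigenvaluesᴿ (λ i j → adjacency (complement D) i j × 1#)
      ((suc m × 1# - r × 1# - δ (σ D) × 1#)
        ∷ map (λ z → - (δ (σ D) × 1#) - z) μ)
  eigenvalues-complement-digraph D r regular = eigenvalues-complement R _ _ _ _ complementary colsum
    where
    complementary : ∀ i j → adjacency D i j × 1# + δ (σ D) × 1# * identity i j +
                            adjacency (complement D) i j × 1# ≈ 1#
    complementary i j = begin
      a × 1# + d × 1# * identity i j + b × 1#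
        ≈⟨ +-congʳ (+-congˡ (*-congˡ (natural-identity i j))) ⟨
      a × 1# + d × 1# * (identityℕ i j × 1#) + b × 1#
        ≈⟨ +-congʳ (+-congˡ (×1-homo-* d (identityℕ i j))) ⟨
      a × 1# + (d ℕ.* identityℕ i j) × 1# + b × 1#
        ≈⟨ +-congʳ (×-homo-+ 1# a (d ℕ.* identityℕ i j)) ⟨
      (a ℕ.+ d ℕ.* identityℕ i j) × 1# + b × 1#
        ≈⟨ ×-homo-+ 1# (a ℕ.+ d ℕ.* identityℕ i j) b ⟨
      (a ℕ.+ d ℕ.* identityℕ i j ℕ.+ b) × 1#
        ≡⟨ ≡.cong (_× 1#) (adjacency-complementary D i j) ⟩
      1 × 1#
        ≈⟨ +-identityʳ 1# ⟩
      1# ∎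
      where
      a = adjacency D i j
      b = adjacency (complement D) i j
      d = δ (σ D)

    colsum : ∀ j → sum (λ i → adjacency D i j × 1#) ≈ r × 1#
    -- A column of the adjacency matrix counts the arcs entering `j`, so its sum is the in-degree.
    colsum j = trans (sym (sum-× (λ i → adjacency D i j)))
      (reflexive (≡.cong (_× 1#) (proj₁ (regular j))))
      where
      sum-× : (v : Vector ℕ n) → MonoidSum.sum ℕ.+-0-monoid v × 1# ≈ sum (λ i → v i × 1#)
      sum-× = sum-homo ℕ.+-0-monoid +-monoid record
        { isMagmaHomomorphism = record
          { isRelHomomorphism = record { cong = ×-congˡ }
          ; homo = ×-homo-+ 1#
          }
        ; ε-homo = refl
        }

lemma5p10 : ∀ {m} (D : Digraph (suc m)) (r : ℕ) → Regular r D →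
    (μ : Vector ℂ m) →
    HasEigenvalues (A D) (fromℕ r ∷ μ) →
    HasEigenvalues (A (complement D))
    ((fromℕ (suc m) -ℂ fromℕ r -ℂ fromℕ (δ (σ D)))
    ∷ map (λ z → -ℂ fromℕ (δ (σ D)) -ℂ z) μ)
lemma5p10 = DigraphSpectrum.eigenvalues-complement-digraph ℂ-commutativeRing
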